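{- Let $n\ge1$, $1\le k\le n$ and $p\in[0,1]$. Consider the unordered search problem on an array $\vec{x}=(x_1,\ldots,x_n)$ of $n$ distinct elements where the target $z$ is chosen uniformly at random among the entries of $\vec{x}$. Then any deterministic algorithm that runs in $k$ rounds and succeeds with probability at least $p$ (over the choice of $z$) asks at least $np\bigl(1-\frac{k-1}{2k}p\bigr)-1$ queries in expectation (over the choice of $z$). Moreover, there is a deterministic algorithm for this problem running in $k$ rounds, succeeding with probability at least $p$, that asks at most $np\bigl(1-\frac{k-1}{2k}p\bigr)+1$ queries in expectation.
   Context: Comparison model: the algorithm may only ask an oracle queries "How is $a$ compared to $b$?" with $a,b\in\{x_1,\ldots,x_n,z\}$, with answer "$<$", "$=$" or "$>$". The goal is to output the index $\ell$ with $z=x_\ell$. An algorithm runs in $k$ rounds if in each of $k$ rounds it submits a set of queries, chosen depending only on answers from earlier rounds, and then receives all their answers. The query count is the total number of queries asked. -}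

module Defs where

open import Algebra.Bundles using (CommutativeRing)
open import Algebra.Core using (Op₁; Op₂)
open import Algebra.Structures using (IsCommutativeRing)
open import Data.Fin using (Fin)
open import Data.List using (List; length; map; filter; allFin)
open import Data.List.Relation.Unary.Unique.Propositional using (Unique)
open import Data.Nat using (ℕ; zero; suc)
import Data.Nat as ℕ
open import Data.Nat.ListAction using (sum)
open import Data.Product using (_×_; _,_; ∃-syntax)
open import Data.Vec using (Vec; fromList)
import Data.Vec as Vec
open import Level using (Level; 0ℓ; _⊔_) renaming (suc to lsuc)
open import Relation.Binary.Bundles using (StrictTotalOrder)
open import Relation.Binary.Core using (Rel)
open import Relation.Binary.Definitions using (Tri; tri<; tri≈; tri>)
open import Relation.Binary.PropositionalEquality using (_≡_)
open import Relation.Binary.Structures using (IsTotalOrder)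
open import Relation.Nullary using (¬_)

-- Probabilities, expectations and the parameter p live in an arbitrary
-- totally ordered field.  Classically ℝ is one, as is ℚ; neither completeness
-- nor the Archimedean property is assumed.  The inverse is a total operation,
-- whose value at 0# is unconstrained.

record OrderedField (c ℓ₁ ℓ₂ : Level) : Set (lsuc (c ⊔ ℓ₁ ⊔ ℓ₂)) where
  infix  8 -_
  infix  9 _⁻¹
  infixl 7 _*_ _/_
  infixl 6 _+_ _-_
  infix  4 _≈_ _≤_
  field
    Carrier           : Set c
    _≈_               : Rel Carrier ℓ₁
    _≤_               : Rel Carrier ℓ₂
    _+_ _*_           : Op₂ Carrier
    -_ _⁻¹            : Op₁ Carrier
    0# 1#             : Carrier
    isCommutativeRing : IsCommutativeRing _≈_ _+_ _*_ -_ 0# 1#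
    isTotalOrder      : IsTotalOrder _≈_ _≤_
    +-monoˡ-≤         : ∀ z {x y} → x ≤ y → x + z ≤ y + z
    *-nonNegative     : ∀ {x y} → 0# ≤ x → 0# ≤ y → 0# ≤ x * y
    0≉1               : ¬ (0# ≈ 1#)
    ⁻¹-cong           : ∀ {x y} → x ≈ y → x ⁻¹ ≈ y ⁻¹
    ⁻¹-inverseʳ       : ∀ x → ¬ (x ≈ 0#) → x * x ⁻¹ ≈ 1#

  commutativeRing : CommutativeRing c ℓ₁
  commutativeRing = record { isCommutativeRing = isCommutativeRing }

  _-_ _/_ : Op₂ Carrier
  x - y = x + (- y)
  x / y = x * y ⁻¹

  fromℕ : ℕ → Carrier
  fromℕ zero    = 0#
  fromℕ (suc n) = 1# + fromℕ n

data Item (n : ℕ) : Set where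
  entry  : Fin n → Item n
  target : Item n

Query : ℕ → Set
Query n = Item n × Item n

data Answer : Set where
  less equal greater : Answer

-- Deterministic algorithms with k rounds, as decision trees: the queries of a
-- round are fixed by the answers received in the earlier rounds.  A set of
-- queries may be empty, so an algorithm may in effect stop early.

data Algorithm (n : ℕ) : ℕ → Set where
  output : Fin n → Algorithm n 0
  round  : ∀ {k} (Q : List (Query n)) → Unique Q →
           (Vec Answer (length Q) → Algorithm n k) → Algorithm n (suc k)

Oracle : ℕ → Set
Oracle n = Query n → Answer

answers : ∀ {n} → Oracle n → (Q : List (Query n)) → Vec Answer (length Q)
answers o Q = Vec.map o (fromList Q)

result : ∀ {n k} → Algorithm n k → Oracle n → Fin n
result (output i)       o = i
result (round Q _ next) o = result (next (answers o Q)) o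

queryCount : ∀ {n k} → Algorithm n k → Oracle n → ℕ
queryCount (output i)       o = 0
queryCount (round Q _ next) o =
  length Q ℕ.+ queryCount (next (answers o Q)) o

-- An array of n distinct elements of some totally ordered set, listed in an
-- arbitrary order that the algorithm does not know.

record Array (n : ℕ) : Set₁ where
  field
    order : StrictTotalOrder 0ℓ 0ℓ 0ℓ
  open StrictTotalOrder order public using (Carrier; _≈_; _<_; _≟_; compare)
  field
    x        : Fin n → Carrier
    distinct : ∀ {i j} → x i ≈ x j → i ≡ j

module _ {n : ℕ} (X : Array n) where
  open Array X

  value : Carrier → Item n → Carrier
  value z (entry i) = x i
  value z target    = z

  toAnswer : ∀ {a b c} {A : Set a} {B : Set b} {C : Set c} → Tri A B C → Answer
  toAnswer (tri< _ _ _) = less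
  toAnswer (tri≈ _ _ _) = equal
  toAnswer (tri> _ _ _) = greater

  oracle : Carrier → Oracle n
  oracle z (a , b) = toAnswer (compare (value z a) (value z b))

  -- The number of entries which, taken as the target, are found.
  successes : ∀ {k} → Algorithm n k → ℕ
  successes A =
    length (filter (λ i → x (result A (oracle (x i))) ≟ x i) (allFin n))

  -- The number of queries summed over all choices of the target.
  totalQueries : ∀ {k} → Algorithm n k → ℕ
  totalQueries A = sum (map (λ i → queryCount A (oracle (x i))) (allFin n))

module _ {c ℓ₁ ℓ₂} (F : OrderedField c ℓ₁ ℓ₂) where
  open OrderedField F

  -- The target is uniform among the n entries.
  successProbability : ∀ {n k} → Algorithm n k → Array n → Carrier
  successProbability {n} A X = fromℕ (successes X A) / fromℕ n

  expectedQueries : ∀ {n k} → Algorithm n k → Array n → Carrier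
  expectedQueries {n} A X = fromℕ (totalQueries X A) / fromℕ n

  -- The algorithm does not know the array, so its guarantees are worst-case
  -- over arrays: success and upper bounds are required on every array, and a
  -- lower bound is attained on some array.
  SucceedsWithProbability : ∀ {n k} → Algorithm n k → Carrier → Set (lsuc 0ℓ ⊔ ℓ₂)
  SucceedsWithProbability A p = ∀ X → p ≤ successProbability A X

  AsksAtMost : ∀ {n k} → Algorithm n k → Carrier → Set (lsuc 0ℓ ⊔ ℓ₂)
  AsksAtMost A b = ∀ X → expectedQueries A X ≤ b

  AsksAtLeast : ∀ {n k} → Algorithm n k → Carrier → Set (lsuc 0ℓ ⊔ ℓ₂)
  AsksAtLeast A b = ∃[ X ] (b ≤ expectedQueries A X)

  bound : ℕ → ℕ → Carrier → Carrier
  bound n k p =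
    fromℕ n * p * (1# - (fromℕ k - 1#) / (fromℕ 2 * fromℕ k) * p)

{-# OPTIONS --safe #-}
module Submission where

-- Lower bound.  Charge each query to at most one of the entries it mentions, and
-- let the adversary place the charged entries, in the order in which they are
-- charged, below all other entries.  Every target not charged so far then gets
-- the same answers, so each round with q queries removes at most q targets from
-- this common branch and costs q for each target that was still on it before the
-- round.  At most one target that is never charged is found.  If D targets are
-- charged in total, Cauchy–Schwarz gives 2kT ≥ 2knD − (k − 1)D² for the total
-- cost T, and success with probability p forces D ≥ np − 1.
--
-- Upper bound.  Compare the target with s = ⌈np⌉ − 1 entries in k rounds of at most
-- ⌊s/k⌋ + 1 entries each, and guess one further entry if none of them is equal.

open import Defs
open import Algebra.Bundles using (CommutativeRing)
import Algebra.Solver.Ring.NaturalCoefficients.Default as NaturalCoefficients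
open import Data.Fin using (Fin; toℕ)
import Data.Fin.Properties as Fin
open import Data.List using (List; []; _∷_; _++_; length; map; filter; mapMaybe; allFin; take; drop)
import Data.List.Membership.DecPropositional as DecMembership
open import Data.List.Membership.Propositional using (_∈_; _∉_)
open import Data.List.Membership.Propositional.Properties using (∈-++⁺ˡ; ∈-++⁺ʳ; ∈-++⁻)
open import Data.List.Properties
  using (++-assoc; ++-identityʳ; map-++; take++drop≡id; length-++; length-drop; length-map;
         length-mapMaybe; length-tabulate; length-take; filter-++; filter-accept; filter-all; filter-none)
import Data.List.Relation.Unary.All as All
open import Data.List.Relation.Unary.AllPairs using ([]; _∷_)
open import Data.List.Relation.Unary.Any using (here; there)
open import Data.List.Relation.Unary.Unique.Propositional using (Unique)
open import Data.List.Relation.Unary.Unique.Propositional.Properties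
  using (allFin⁺; map⁺; take⁺; drop⁺)
open import Data.Maybe using (Maybe; just; nothing; maybe′)
import Data.Nat as ℕ
open import Data.Nat using (ℕ; zero; suc; z≤n; s≤s)
import Data.Nat.Properties as ℕ
open import Data.Product using (_×_; _,_; ∃-syntax; proj₁; proj₂)
open import Data.Sum using (_⊎_; inj₁; inj₂; [_,_]′)
open import Data.Vec using (Vec; []; _∷_)
open import Function using (_∘_; id)
open import Relation.Binary.Bundles using (Poset; StrictTotalOrder)
open import Relation.Binary.Definitions using (tri<; tri≈; tri>)
import Relation.Binary.Reasoning.PartialOrder as PartialOrderReasoning
open import Relation.Binary.Structures using (IsTotalOrder)
open import Relation.Nullary using (¬_; yes; no; contradiction)
open import Relation.Nullary.Decidable using (¬?)
open import Relation.Unary using (Pred; Decidable)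

module Counting where

  open import Data.Nat using (_+_; _*_; _∸_; _⊓_; _≤_; _<_)
  open import Data.Nat.DivMod using (_/_; _%_; m≡m%n+[m/n]*n; m%n<n; m/n*n≤m)
  open import Data.Nat.ListAction using (sum)
  open import Data.Nat.ListAction.Properties using (sum-++)
  open import Data.Nat.Properties hiding (_≟_)
  open import Data.Nat.Solver using (module +-*-Solver)
  open import Relation.Binary.PropositionalEquality

  -- Counting and summing over filtered lists.

  module _ {a p q} {A : Set a} {P : Pred A p} {Q : Pred A q}
           (P? : Decidable P) (Q? : Decidable Q) where

    sum-filter-mono : {f g : A → ℕ} → (∀ x → P x → Q x × f x ≤ g x) → ∀ xs →
                      sum (map f (filter P? xs)) ≤ sum (map g (filter Q? xs))
    sum-filter-mono P⇒Q [] = z≤n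
    sum-filter-mono P⇒Q (x ∷ xs) with P? x | Q? x
    ... | yes Px | yes _  = +-mono-≤ (proj₂ (P⇒Q x Px)) (sum-filter-mono P⇒Q xs)
    ... | yes Px | no ¬Qx = contradiction (proj₁ (P⇒Q x Px)) ¬Qx
    ... | no _   | yes _  = m≤n⇒m≤o+n _ (sum-filter-mono P⇒Q xs)
    ... | no _   | no _   = sum-filter-mono P⇒Q xs

    module _ {r} {R : Pred A r} (R? : Decidable R) where

      length-filter-∪ : (∀ x → P x → Q x ⊎ R x) → ∀ xs →
        length (filter P? xs) ≤ length (filter Q? xs) + length (filter R? xs)
      length-filter-∪ P⇒Q∪R [] = z≤n
      length-filter-∪ P⇒Q∪R (x ∷ xs)
        with ih ← length-filter-∪ P⇒Q∪R xs | P? x | Q? x | R? x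
      ... | no _   | no _  | no _  = ih
      ... | no _   | no _  | yes _ = ≤-trans ih (+-monoʳ-≤ _ (n≤1+n _))
      ... | no _   | yes _ | no _  = m≤n⇒m≤1+n ih
      ... | no _   | yes _ | yes _ = m≤n⇒m≤1+n (≤-trans ih (+-monoʳ-≤ _ (n≤1+n _)))
      ... | yes _  | yes _ | no _  = s≤s ih
      ... | yes _  | yes _ | yes _ = s≤s (≤-trans ih (+-monoʳ-≤ _ (n≤1+n _)))
      ... | yes _  | no _  | yes _ = ≤-trans (s≤s ih) (≤-reflexive (sym (+-suc _ _)))
      ... | yes Px | no ¬Qx | no ¬Rx = contradiction (P⇒Q∪R x Px) [ ¬Qx , ¬Rx ]′

  length-filter-⊆ : ∀ {a p q} {A : Set a} {P : Pred A p} {Q : Pred A q}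
    (P? : Decidable P) (Q? : Decidable Q) → (∀ x → P x → Q x) → ∀ xs →
    length (filter P? xs) ≤ length (filter Q? xs)
  length-filter-⊆ P? Q? P⇒Q [] = z≤n
  length-filter-⊆ P? Q? P⇒Q (x ∷ xs)
    with ih ← length-filter-⊆ P? Q? P⇒Q xs | P? x | Q? x
  ... | yes _  | yes _  = s≤s ih
  ... | yes Px | no ¬Qx = contradiction (P⇒Q x Px) ¬Qx
  ... | no _   | yes _  = m≤n⇒m≤1+n ih
  ... | no _   | no _   = ih

  length-filter-¬ : ∀ {a p} {A : Set a} {P : Pred A p} (P? : Decidable P) → ∀ xs →
    length (filter P? xs) + length (filter (¬? ∘ P?) xs) ≡ length xs
  length-filter-¬ P? [] = refl
  length-filter-¬ P? (x ∷ xs) with ih ← length-filter-¬ P? xs | P? x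
  ... | yes _ = cong suc ih
  ... | no _  = trans (+-suc _ _) (cong suc ih)

  sum-map-+ : ∀ {a} {A : Set a} q (f : A → ℕ) xs →
              sum (map (λ x → q + f x) xs) ≡ q * length xs + sum (map f xs)
  sum-map-+ q f [] = cong (_+ 0) (sym (*-zeroʳ q))
  sum-map-+ q f (x ∷ xs) rewrite sum-map-+ q f xs =
    solve 4 (λ q y l s → (q :+ y) :+ (q :* l :+ s) := q :* (con 1 :+ l) :+ (y :+ s))
      refl q (f x) (length xs) (sum (map f xs))
    where open +-*-Solver

  answers-cong : ∀ {n} {o o′ : Oracle n} (Q : List (Query n)) →
                 (∀ q → q ∈ Q → o q ≡ o′ q) → answers o Q ≡ answers o′ Q
  answers-cong []      o≗o′ = refl
  answers-cong (q ∷ Q) o≗o′ =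
    cong₂ _∷_ (o≗o′ q (here refl)) (answers-cong Q (λ q → o≗o′ q ∘ there))

  length-filter-≡ : ∀ {n} (i : Fin n) → ∀ {xs} → Unique xs → length (filter (Fin._≟ i) xs) ≤ 1
  length-filter-≡ i [] = z≤n
  length-filter-≡ i {x ∷ xs} (x∉xs ∷ u) with x Fin.≟ i
  ... | no _ = length-filter-≡ i u
  ... | yes refl =
    s≤s (≤-reflexive (cong length (filter-none (Fin._≟ i) (All.map ≢-sym x∉xs))))

  module _ {n : ℕ} where

    open DecMembership (Fin._≟_ {n}) using (_∈?_; _∉?_)

    length-filter-∈ : ∀ {xs} → Unique xs → (L : List (Fin n)) → length (filter (_∈? L) xs) ≤ length L
    length-filter-∈ {xs} u [] =
      ≤-reflexive (cong length (filter-none (_∈? []) (All.universal (λ _ ()) xs)))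
    length-filter-∈ {xs} u (i ∷ L) =
      ≤-trans (length-filter-∪ (_∈? (i ∷ L)) (Fin._≟ i) (_∈? L)
                (λ { x (here eq) → inj₁ eq ; x (there x∈L) → inj₂ x∈L }) xs)
              (+-mono-≤ (length-filter-≡ i u) (length-filter-∈ u L))

    -- Arrays ordered by a list of charged entries.

    -- Charged entries get the lowest keys, in the order of their first charge. Appending to `L`
    -- therefore leaves the keys of entries on `L` unchanged and keeps all others at `length L` or
    -- above, so the adversary can commit to the order piece by piece.
    rank : List (Fin n) → Fin n → ℕ
    rank []      i = toℕ i
    rank (j ∷ L) i with i Fin.≟ j
    ... | yes _ = 0
    ... | no _  = suc (rank L i)

    rank-injective : ∀ L {i j} → rank L i ≡ rank L j → i ≡ j
    rank-injective [] eq = Fin.toℕ-injective eq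
    rank-injective (l ∷ L) {i} {j} eq with i Fin.≟ l | j Fin.≟ l
    ... | yes refl | yes refl = refl
    ... | no _     | no _     = rank-injective L (suc-injective eq)

    rank-dead : ∀ {L i} → i ∈ L → rank L i < length L
    rank-dead {l ∷ L} {i} i∈L with i Fin.≟ l
    ... | yes _ = s≤s z≤n
    rank-dead (here eq)   | no i≢l = contradiction eq i≢l
    rank-dead (there i∈L) | no _   = s≤s (rank-dead i∈L)

    rank-++ : ∀ {L i} M → i ∈ L → rank (L ++ M) i ≡ rank L i
    rank-++ {l ∷ L} {i} M i∈L with i Fin.≟ l
    ... | yes _ = refl
    rank-++ M (here eq)   | no i≢l = contradiction eq i≢l
    rank-++ M (there i∈L) | no _   = cong suc (rank-++ M i∈L)

    rank-live : ∀ {L i} M → i ∉ L → length L ≤ rank (L ++ M) i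
    rank-live {[]}        M i∉L = z≤n
    rank-live {l ∷ L} {i} M i∉L with i Fin.≟ l
    ... | yes i≡l = contradiction (here i≡l) i∉L
    ... | no _    = s≤s (rank-live M (i∉L ∘ there))

    ranked : List (Fin n) → Array n
    ranked L = record
      { order    = <-strictTotalOrder
      ; x        = rank L
      ; distinct = rank-injective L
      }

    oracleᵣ : List (Fin n) → ℕ → Oracle n
    oracleᵣ L = oracle (ranked L)

    toAnswer-< : ∀ L {a b} → a < b → toAnswer (ranked L) (<-cmp a b) ≡ less
    toAnswer-< L {a} {b} a<b with <-cmp a b
    ... | tri< _ _ _   = refl
    ... | tri≈ a≮b _ _ = contradiction a<b a≮b
    ... | tri> a≮b _ _ = contradiction a<b a≮b

    toAnswer-≈ : ∀ L {a} → toAnswer (ranked L) (<-cmp a a) ≡ equal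
    toAnswer-≈ L {a} with <-cmp a a
    ... | tri< _ a≢a _ = contradiction refl a≢a
    ... | tri≈ _ _ _   = refl
    ... | tri> _ a≢a _ = contradiction refl a≢a

    toAnswer-> : ∀ L {a b} → b < a → toAnswer (ranked L) (<-cmp a b) ≡ greater
    toAnswer-> L {a} {b} b<a with <-cmp a b
    ... | tri< _ _ b≮a = contradiction b<a b≮a
    ... | tri≈ _ _ b≮a = contradiction b<a b≮a
    ... | tri> _ _ _   = refl

    -- `toAnswer` takes the array as a parameter, so the two sides reduce to the same answer only
    -- after a case split on the comparison.
    toAnswer-irr : ∀ L L′ {a b} → toAnswer (ranked L) (<-cmp a b) ≡ toAnswer (ranked L′) (<-cmp a b)
    toAnswer-irr L L′ {a} {b} with <-cmp a b
    ... | tri< _ _ _ = refl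
    ... | tri≈ _ _ _ = refl
    ... | tri> _ _ _ = refl

    -- Charging queries, and answers that are known in advance.

    -- One charge per query suffices, even for two entries: a charged entry lies below everything
    -- uncharged, and its order relative to the other charged entries is already fixed. Comparing
    -- the target with itself reveals nothing and is free.
    victim : Query n → Maybe (Fin n)
    victim (entry i , _      ) = just i
    victim (target  , entry j) = just j
    victim (target  , target ) = nothing

    ∈-victims : ∀ {Q q i} → q ∈ Q → victim q ≡ just i → i ∈ mapMaybe victim Q
    ∈-victims {q ∷ Q} (here refl) eq rewrite eq = here refl
    ∈-victims {q ∷ Q} (there q∈Q) eq with victim q
    ... | just _  = there (∈-victims q∈Q eq)
    ... | nothing = ∈-victims q∈Q eq

    module _ {L : List (Fin n)} (M : List (Fin n)) {z : Fin n} (z∉L : z ∉ L) where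

      private
        v w : Item n → ℕ
        v = value (ranked (L ++ M)) (rank (L ++ M) z)
        -- `v` is the real run with the final order and target `z`; `w` replaces the target by the
        -- threshold `length L` above all charged keys and mentions neither `M` nor `z`.
        w = value (ranked L) (length L)

        position : ∀ b → (v b ≡ w b × w b < length L) ⊎ (length L ≤ v b × length L ≤ w b)
        position target = inj₂ (rank-live M z∉L , ≤-refl)
        position (entry i) with i ∈? L
        ... | yes i∈L = inj₁ (rank-++ M i∈L , rank-dead i∈L)
        ... | no  i∉L = inj₂ (rank-live M i∉L , subst (λ N → length L ≤ rank N i) (++-identityʳ L) (rank-live [] i∉L))

      -- Unless the target is compared with itself, one side of the query is a charged entry, whose
      -- key is final and below `length L`. The other side either has its final key too or lies at
      -- or above `length L` in both runs. So the answer is settled before later charges and the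
      -- target are known.
      oracle-stable : ∀ q → (∀ {i} → victim q ≡ just i → i ∈ L) →
                      oracleᵣ (L ++ M) (rank (L ++ M) z) q ≡ oracleᵣ L (length L) q
      oracle-stable (target , target) dead = trans (toAnswer-≈ (L ++ M) {rank (L ++ M) z}) (sym (toAnswer-≈ L {length L}))
      oracle-stable (entry i , b) dead rewrite rank-++ M (dead refl) with position b
      ... | inj₁ (vb≡wb , _) rewrite vb≡wb = toAnswer-irr (L ++ M) L
      ... | inj₂ (vb , wb) =
        trans (toAnswer-< (L ++ M) (<-≤-trans (rank-dead (dead refl)) vb))
              (sym (toAnswer-< L (<-≤-trans (rank-dead (dead refl)) wb)))
      oracle-stable (target , entry j) dead rewrite rank-++ M (dead refl) =
        trans (toAnswer-> (L ++ M) (<-≤-trans (rank-dead (dead refl)) (rank-live M z∉L)))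
              (sym (toAnswer-> L (rank-dead (dead refl))))

    live : List (Fin n) → ℕ
    live L = length (filter (_∉? L) (allFin n))

    runCost : ∀ {j} → Algorithm n j → List (Fin n) → Fin n → ℕ
    runCost A L∞ z = queryCount A (oracleᵣ L∞ (rank L∞ z))

    -- Two lists occur because costs are measured on the final order `L∞`, while the sum ranges over
    -- the targets still on the common branch when the subtree `A` is reached, that is, those not in
    -- `L`.
    liveCost : ∀ {j} → Algorithm n j → List (Fin n) → List (Fin n) → ℕ
    liveCost A L∞ L = sum (map (runCost A L∞) (filter (_∉? L) (allFin n)))

  -- Arithmetic of the cost bound.

  2xy≤x²+y² : ∀ x y → 2 * (x * y) ≤ x * x + y * y
  2xy≤x²+y² x y with ≤-total x y
  ... | inj₁ x≤y with d , refl ← m≤n⇒∃[o]m+o≡n x≤y = m+n≤o⇒m≤o _ (≤-reflexive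
    (solve 2 (λ x d → con 2 :* (x :* (x :+ d)) :+ d :* d := x :* x :+ (x :+ d) :* (x :+ d)) refl x d))
    where open +-*-Solver
  ... | inj₂ y≤x with d , refl ← m≤n⇒∃[o]m+o≡n y≤x = m+n≤o⇒m≤o _ (≤-reflexive
    (solve 2 (λ y d → con 2 :* ((y :+ d) :* y) :+ d :* d := (y :+ d) :* (y :+ d) :+ y :* y) refl y d))
    where open +-*-Solver

  -- For D = m ∸ e and j = k this is the Cauchy–Schwarz bound on ∑ᵢ dᵢ² for
  -- d₁ + … + dₖ = D; the tangent form 2 k D dᵢ ≤ k² dᵢ² + D² can be summed round by round.
  CostBound : (k j D m e T : ℕ) → Set
  CostBound k j D m e T =
    k * k * (m * m) + 2 * (k * D * m) ≤
    2 * (k * k * T) + k * k * (e * e) + j * (D * D) + 2 * (k * D * e)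

  -- If the round charges `d = m − m′ ≤ q` new targets, it costs at least `d * m`, and 2dm exceeds
  -- m² - m′² by d². Together with the additional D² granted for the round, the surplus k²d² pays
  -- for 2kDd by the inequality between squares and product.
  costBound-step : ∀ {k j D m m′ e q T T′} → m′ ≤ m → m ≤ m′ + q → q * m + T′ ≤ T →
                   CostBound k j D m′ e T′ → CostBound k (suc j) D m e T
  costBound-step {k} {j} {D} {m} {m′} {e} {q} {T} {T′} m′≤m m≤m′+q T≥ ih
    with d , refl ← m≤n⇒∃[o]m+o≡n m′≤m = begin
    k * k * ((m′ + d) * (m′ + d)) + 2 * (k * D * (m′ + d))
      ≡⟨ solve 4 (λ k D m d →
           k :* k :* ((m :+ d) :* (m :+ d)) :+ con 2 :* (k :* D :* (m :+ d)) :=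
           (k :* k :* (m :* m) :+ con 2 :* (k :* D :* m)) :+ con 2 :* ((k :* d) :* D)
           :+ (k :* k :* (d :* d) :+ con 2 :* (k :* k :* (d :* m)))) refl k D m′ d ⟩
    (k * k * (m′ * m′) + 2 * (k * D * m′)) + 2 * ((k * d) * D) + (k * k * (d * d) + 2 * (k * k * (d * m′)))
      ≤⟨ +-monoˡ-≤ _ (+-mono-≤ ih (2xy≤x²+y² (k * d) D)) ⟩
    (2 * (k * k * T′) + k * k * (e * e) + j * (D * D) + 2 * (k * D * e)) + (k * d * (k * d) + D * D)
      + (k * k * (d * d) + 2 * (k * k * (d * m′)))
      ≡⟨ solve 7 (λ k j D m e d T →
           (con 2 :* (k :* k :* T) :+ k :* k :* (e :* e) :+ j :* (D :* D) :+ con 2 :* (k :* D :* e))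
           :+ (k :* d :* (k :* d) :+ D :* D) :+ (k :* k :* (d :* d) :+ con 2 :* (k :* k :* (d :* m))) :=
           con 2 :* (k :* k :* (d :* (m :+ d) :+ T)) :+ k :* k :* (e :* e)
           :+ (con 1 :+ j) :* (D :* D) :+ con 2 :* (k :* D :* e)) refl k j D m′ e d T′ ⟩
    2 * (k * k * (d * (m′ + d) + T′)) + k * k * (e * e) + suc j * (D * D) + 2 * (k * D * e)
      ≤⟨ +-monoˡ-≤ _ (+-monoˡ-≤ _ (+-monoˡ-≤ _ (*-monoʳ-≤ 2 (*-monoʳ-≤ (k * k) T-bound)))) ⟩
    2 * (k * k * T) + k * k * (e * e) + suc j * (D * D) + 2 * (k * D * e) ∎
    where
    open ≤-Reasoning
    open +-*-Solver
    T-bound : d * (m′ + d) + T′ ≤ T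
    T-bound = ≤-trans (+-monoˡ-≤ T′ (*-monoˡ-≤ (m′ + d) (+-cancelˡ-≤ m′ d q m≤m′+q))) T≥

  -- The adversary, and the lower bound in natural numbers.

  module _ {n : ℕ} where

    open DecMembership (Fin._≟_ {n}) using (_∈?_; _∉?_)

    -- Induction on the rounds: charge the victims of this round first, compute the answers at the
    -- threshold, and continue in the subtree that they select. Targets that are never charged all
    -- follow this branch, so one output `r` serves them all. The bound is proved for every `D`
    -- because the number of charged targets is known only at the end.
    adversary : ∀ {j} (A : Algorithm n j) (L : List (Fin n)) → ∃[ L∞ ]
      (∃[ M ] L∞ ≡ L ++ M) ×
      (∃[ r ] (∀ z → z ∉ L∞ → result A (oracleᵣ L∞ (rank L∞ z)) ≡ r)) ×
      (∀ k D → CostBound k j D (live L) (live L∞) (liveCost A L∞ L))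
    adversary (output i) L =
      L , ([] , sym (++-identityʳ L)) , (i , λ _ _ → refl) , λ k D →
      +-monoˡ-≤ _ (≤-trans (m≤n+m _ (2 * (k * k * liveCost (output i) L L))) (m≤m+n _ 0))
    adversary {suc j} (round Q unique next) L
      with L∞ , (M , refl) , (r , result≡r) , costBound ←
           adversary (next (answers (oracleᵣ (L ++ mapMaybe victim Q) (length (L ++ mapMaybe victim Q))) Q))
                     (L ++ mapMaybe victim Q) =
      L∞ , (mapMaybe victim Q ++ M , ++-assoc L _ M) , (r , λ z z∉L∞ →
        trans (cong (λ as → result (next as) (oracleᵣ L∞ (rank L∞ z))) (agree z (z∉L∞ ∘ ∈-++⁺ˡ))) (result≡r z z∉L∞)) ,
      λ k D → costBound-step {k} {j} {D} {q = length Q} live′≤live live≤ cost≥ (costBound k D)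
      where
      L′ : List (Fin n)
      L′ = L ++ mapMaybe victim Q
      A′ : Algorithm n j
      A′ = next (answers (oracleᵣ L′ (length L′)) Q)
      o : Fin n → Oracle n
      o z = oracleᵣ (L′ ++ M) (rank (L′ ++ M) z)
      agree : ∀ z → z ∉ L′ → answers (o z) Q ≡ answers (oracleᵣ L′ (length L′)) Q
      agree z z∉L′ = answers-cong Q (λ q q∈Q →
        oracle-stable M z∉L′ q (λ eq → ∈-++⁺ʳ L (∈-victims q∈Q eq)))
      live′≤live : live L′ ≤ live L
      live′≤live = length-filter-⊆ (_∉? L′) (_∉? L) (λ _ z∉L′ → z∉L′ ∘ ∈-++⁺ˡ) (allFin n)
      live≤ : live L ≤ live L′ + length Q
      live≤ = ≤-trans
        (length-filter-∪ (_∉? L) (_∉? L′) (_∈? mapMaybe victim Q) split (allFin n))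
        (+-monoʳ-≤ (live L′) (≤-trans (length-filter-∈ (allFin⁺ n) _) (length-mapMaybe victim Q)))
        where
        split : ∀ z → z ∉ L → z ∉ L′ ⊎ z ∈ mapMaybe victim Q
        split z z∉L with z ∈? mapMaybe victim Q
        ... | yes z∈ = inj₂ z∈
        ... | no z∉  = inj₁ ([ z∉L , z∉ ]′ ∘ ∈-++⁻ L)
      cost≥ : length Q * live L + liveCost A′ (L′ ++ M) L′ ≤ liveCost (round Q unique next) (L′ ++ M) L
      cost≥ = ≤-trans
        -- Targets charged in this round pay for its queries only; whatever they cost later is
        -- dropped.
        (+-monoʳ-≤ (length Q * live L) (sum-filter-mono (_∉? L′) (_∉? L)
          (λ z z∉L′ → z∉L′ ∘ ∈-++⁺ˡ ,
             ≤-reflexive (cong (λ as → queryCount (next as) (o z)) (sym (agree z z∉L′))))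
          (allFin n)))
        (≤-reflexive (sym (sum-map-+ (length Q) (λ z → queryCount (next (answers (o z) Q)) (o z))
          (filter (_∉? L) (allFin n)))))

    -- `D` counts the charged entries without repetition, and the successes are among these and the
    -- common output `r`. The last inequality is 2kT ≥ 2knD - (k - 1)D² with the subtraction moved
    -- across.
    lowerBound : ∀ {k} → 1 ≤ k → (A : Algorithm n k) → ∃[ X ] ∃[ D ]
      D ≤ n × successes X A ≤ suc D ×
      2 * (k * (n * D)) + D * D ≤ 2 * (k * totalQueries X A) + k * (D * D)
    lowerBound {k@(suc _)} _ A with L , _ , (r , result≡r) , costBound ← adversary A [] =
      ranked L , D , m+n≤o⇒m≤o D (≤-reflexive D+e≡n) , successes≤ , final
      where
      D e T : ℕ
      D = length (filter (_∈? L) (allFin n))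
      e = live L
      T = totalQueries (ranked L) A
      D+e≡n : D + e ≡ n
      D+e≡n = trans (length-filter-¬ (_∈? L) (allFin n)) (length-tabulate id)
      all-live : filter (_∉? []) (allFin n) ≡ allFin n
      all-live = filter-all (_∉? []) (All.universal (λ _ ()) (allFin n))
      successes≤ : successes (ranked L) A ≤ suc D
      successes≤ = ≤-trans (length-filter-∪ _ (Fin._≟ r) (_∈? L) split (allFin n))
        (+-monoˡ-≤ D (length-filter-≡ r (allFin⁺ n)))
        where
        split : ∀ z → rank L (result A (oracleᵣ L (rank L z))) ≡ rank L z → z ≡ r ⊎ z ∈ L
        split z success with z ∈? L
        ... | yes z∈L = inj₂ z∈L
        ... | no z∉L  = inj₁ (trans (sym (rank-injective L success)) (result≡r z z∉L))
      total-bound : CostBound k k D (D + e) e T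
      total-bound = subst₂ (λ m T → CostBound k k D m e T)
        (trans (trans (cong length all-live) (length-tabulate id)) (sym D+e≡n))
        (cong (sum ∘ map (runCost A L)) all-live) (costBound k D)
      open +-*-Solver
      open ≤-Reasoning
      -- For `j = k` every term of the cost bound has a factor `k`, which is cancelled together with
      -- the terms common to both sides.
      core : D * D * k + 2 * (k * (D * e)) + D * D ≤ 2 * (k * T)
      core = *-cancelˡ-≤ k (+-cancelʳ-≤ (k * k * (e * e) + k * (D * D) + 2 * (k * D * e)) _ _ (begin
        _ ≡⟨ solve 3 (λ k D e → k :* (D :* D :* k :+ con 2 :* (k :* (D :* e)) :+ D :* D)
                   :+ (k :* k :* (e :* e) :+ k :* (D :* D) :+ con 2 :* (k :* D :* e)) :=
               k :* k :* ((D :+ e) :* (D :+ e)) :+ con 2 :* (k :* D :* (D :+ e))) refl k D e ⟩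
        _ ≤⟨ total-bound ⟩
        _ ≡⟨ solve 4 (λ k D e T → con 2 :* (k :* k :* T) :+ k :* k :* (e :* e) :+ k :* (D :* D) :+ con 2 :* (k :* D :* e) :=
               k :* (con 2 :* (k :* T)) :+ (k :* k :* (e :* e) :+ k :* (D :* D) :+ con 2 :* (k :* D :* e))) refl k D e T ⟩
        _ ∎))
      final : 2 * (k * (n * D)) + D * D ≤ 2 * (k * T) + k * (D * D)
      final = begin
        2 * (k * (n * D)) + D * D ≡⟨ cong (λ n → 2 * (k * (n * D)) + D * D) (sym D+e≡n) ⟩
        2 * (k * ((D + e) * D)) + D * D
          ≡⟨ solve 3 (λ k D e → con 2 :* (k :* ((D :+ e) :* D)) :+ D :* D :=
               (D :* D :* k :+ con 2 :* (k :* (D :* e)) :+ D :* D) :+ k :* (D :* D)) refl k D e ⟩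
        _ ≤⟨ +-monoˡ-≤ (k * (D * D)) core ⟩
        2 * (k * T) + k * (D * D) ∎

  -- The search algorithm and its cost.

  sum-map-≤ : ∀ {a} {A : Set a} {f g : A → ℕ} → (∀ x → f x ≤ g x) → ∀ xs →
              sum (map f xs) ≤ sum (map g xs)
  sum-map-≤ f≤g []       = z≤n
  sum-map-≤ f≤g (x ∷ xs) = +-mono-≤ (f≤g x) (sum-map-≤ f≤g xs)

  sum-map-bounded : ∀ {a} {A : Set a} {f : A → ℕ} {c} xs → (∀ x → x ∈ xs → f x ≤ c) →
              sum (map f xs) ≤ length xs * c
  sum-map-bounded []       f≤c = z≤n
  sum-map-bounded (x ∷ xs) f≤c = +-mono-≤ (f≤c x (here refl)) (sum-map-bounded xs (λ y → f≤c y ∘ there))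

  module _ {n : ℕ} where

    open DecMembership (Fin._≟_ {n}) using (_∈?_)

    -- Pads the remaining rounds with empty query sets once the target is known.
    idle : ∀ k → Fin n → Algorithm n k
    idle zero    i = output i
    idle (suc k) i = round [] [] (λ _ → idle k i)

    result-idle : ∀ k i o → result (idle k i) o ≡ i
    result-idle zero    i o = refl
    result-idle (suc k) i o = result-idle k i o

    queryCount-idle : ∀ k i o → queryCount (idle k i) o ≡ 0
    queryCount-idle zero    i o = refl
    queryCount-idle (suc k) i o = queryCount-idle k i o

    probe : Fin n → Query n
    probe i = target , entry i

    probe-injective : ∀ {i j} → probe i ≡ probe j → i ≡ j
    probe-injective refl = refl

    findEqual : (is : List (Fin n)) → Vec Answer (length (map probe is)) → Maybe (Fin n)
    findEqual []       []             = nothing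
    findEqual (i ∷ is) (less    ∷ as) = findEqual is as
    findEqual (i ∷ is) (equal   ∷ as) = just i
    findEqual (i ∷ is) (greater ∷ as) = findEqual is as

    -- `a` bounds the probes per round, `is` lists the candidates not yet probed, and `g` is the
    -- guess made if no probe succeeds; the guess costs no query.
    search : ∀ k → ℕ → (is : List (Fin n)) → Unique is → Fin n → Algorithm n k
    search zero    a is u g = output g
    search (suc k) a is u g =
      round (map probe (take a is)) (map⁺ probe-injective (take⁺ a u))
        (λ as → maybe′ (idle k) (search k a (drop a is) (drop⁺ a u) g) (findEqual (take a is) as))

    module _ (X : Array n) (j : Fin n) where

      open Array X using (x; compare; distinct; order)
      open StrictTotalOrder order using (module Eq)

      private
        o : Oracle n
        o = oracle X (x j)

      findEqual-∈ : ∀ {is} → j ∈ is → findEqual is (answers o (map probe is)) ≡ just j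
      findEqual-∈ {i ∷ is} j∈is with compare (x j) (x i)
      ... | tri≈ _ xj≈xi _ = cong just (sym (distinct xj≈xi))
      findEqual-∈ (here refl)  | tri< _ xj≉xi _ = contradiction Eq.refl xj≉xi
      findEqual-∈ (there j∈is) | tri< _ _ _     = findEqual-∈ j∈is
      findEqual-∈ (here refl)  | tri> _ xj≉xi _ = contradiction Eq.refl xj≉xi
      findEqual-∈ (there j∈is) | tri> _ _ _     = findEqual-∈ j∈is

      findEqual-∉ : ∀ is → j ∉ is → findEqual is (answers o (map probe is)) ≡ nothing
      findEqual-∉ [] j∉is = refl
      findEqual-∉ (i ∷ is) j∉is with compare (x j) (x i)
      ... | tri≈ _ xj≈xi _ = contradiction (here (distinct xj≈xi)) j∉is
      ... | tri< _ _ _     = findEqual-∉ is (j∉is ∘ there)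
      ... | tri> _ _ _     = findEqual-∉ is (j∉is ∘ there)

      result-search-∈ : ∀ k a is u g → length is ≤ k * a → j ∈ is → result (search k a is u g) o ≡ j
      result-search-∈ zero a [] u g _ ()
      result-search-∈ (suc k) a is u g len j∈is with j ∈? take a is
      ... | yes j∈ rewrite findEqual-∈ j∈ = result-idle k j o
      ... | no j∉ rewrite findEqual-∉ (take a is) j∉ =
        result-search-∈ k a (drop a is) (drop⁺ a u) g
          (≤-trans (≤-reflexive (length-drop a is)) (m≤n+o⇒m∸n≤o _ a len))
          ([ (λ j∈ → contradiction j∈ j∉) , id ]′ (∈-++⁻ (take a is) (subst (j ∈_) (sym (take++drop≡id a is)) j∈is)))

      result-search-∉ : ∀ k a is u g → j ∉ is → result (search k a is u g) o ≡ g
      result-search-∉ zero    a is u g j∉is = refl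
      result-search-∉ (suc k) a is u g j∉is
        rewrite findEqual-∉ (take a is) (λ j∈ → j∉is (subst (j ∈_) (take++drop≡id a is) (∈-++⁺ˡ j∈))) =
        result-search-∉ k a (drop a is) (drop⁺ a u) g
          (λ j∈ → j∉is (subst (j ∈_) (take++drop≡id a is) (∈-++⁺ʳ (take a is) j∈)))

      queryCount-search-∈ : ∀ k a is u g → j ∈ take a is →
        queryCount (search (suc k) a is u g) o ≡ length (take a is)
      queryCount-search-∈ k a is u g j∈ rewrite findEqual-∈ j∈ | queryCount-idle k j o =
        trans (+-identityʳ _) (length-map probe (take a is))

      queryCount-search : ∀ k a is u g →
        queryCount (search (suc k) a is u g) o ≤
        length (take a is) + queryCount (search k a (drop a is) (drop⁺ a u) g) o
      queryCount-search k a is u g with j ∈? take a is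
      ... | yes j∈ = m≤n⇒m≤n+o _ (≤-reflexive (queryCount-search-∈ k a is u g j∈))
      ... | no j∉ rewrite findEqual-∉ (take a is) j∉ = +-monoˡ-≤ _ (≤-reflexive (length-map probe (take a is)))

    module _ (X : Array n) where

      open Array X using (x)

      searchCost : ∀ k a is → Unique is → Fin n → List (Fin n) → ℕ
      searchCost k a is u g js = sum (map (λ j → queryCount (search k a is u g) (oracle X (x j))) js)

      -- A potential argument with φ(m) = m² + am, where m counts the targets not yet found. A round
      -- with d probes that leaves m targets costs d for each of d + m targets, and 2d(d + m) ≤ φ(d
      -- + m) - φ(m) because d ≤ a. The targets in `rest` are never probed, so the sum telescopes
      -- down to φ(e).
      searchCost-bound : ∀ k a is u g rest →
        let e = length rest; m = length (is ++ rest) in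
        2 * searchCost k a is u g (is ++ rest) + e * e + a * e ≤ m * m + a * m
      searchCost-bound zero a is u g rest = begin
        2 * searchCost 0 a is u g (is ++ rest) + e * e + a * e
          ≡⟨ cong (λ T → 2 * T + e * e + a * e) (no-queries (is ++ rest)) ⟩
        e * e + a * e ≤⟨ +-mono-≤ (*-mono-≤ e≤m e≤m) (*-monoʳ-≤ a e≤m) ⟩
        m * m + a * m ∎
        where
        open ≤-Reasoning
        e m : ℕ
        e = length rest
        m = length (is ++ rest)
        e≤m : e ≤ m
        e≤m = ≤-trans (m≤n+m e (length is)) (≤-reflexive (sym (length-++ is)))
        no-queries : ∀ js → searchCost 0 a is u g js ≡ 0
        no-queries []       = refl
        no-queries (_ ∷ js) = no-queries js
      searchCost-bound (suc k) a is u g rest = begin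
        2 * searchCost (suc k) a is u g (is ++ rest) + e * e + a * e
          ≤⟨ +-monoˡ-≤ _ (+-monoˡ-≤ _ (*-monoʳ-≤ 2 cost≤)) ⟩
        2 * (d * d + (d * m + T)) + e * e + a * e
          ≡⟨ solve 5 (λ d m T e a → con 2 :* (d :* d :+ (d :* m :+ T)) :+ e :* e :+ a :* e :=
               d :* d :+ (d :* d :+ con 2 :* (d :* m)) :+ (con 2 :* T :+ e :* e :+ a :* e)) refl d m T e a ⟩
        d * d + (d * d + 2 * (d * m)) + (2 * T + e * e + a * e)
          ≤⟨ +-mono-≤ (+-monoˡ-≤ _ (*-monoˡ-≤ d d≤a)) (searchCost-bound k a (drop a is) (drop⁺ a u) g rest) ⟩
        a * d + (d * d + 2 * (d * m)) + (m * m + a * m)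
          ≡⟨ solve 3 (λ d m a → a :* d :+ (d :* d :+ con 2 :* (d :* m)) :+ (m :* m :+ a :* m) :=
               (d :+ m) :* (d :+ m) :+ a :* (d :+ m)) refl d m a ⟩
        (d + m) * (d + m) + a * (d + m)
          ≡⟨ cong (λ l → l * l + a * l) (sym (trans (cong length split) (length-++ now))) ⟩
        length (is ++ rest) * length (is ++ rest) + a * length (is ++ rest) ∎
        where
        open ≤-Reasoning
        open +-*-Solver
        now later : List (Fin n)
        now = take a is
        later = drop a is ++ rest
        d m e T : ℕ
        d = length now
        m = length later
        e = length rest
        T = searchCost k a (drop a is) (drop⁺ a u) g later
        d≤a : d ≤ a
        d≤a = ≤-trans (≤-reflexive (length-take a is)) (m⊓n≤m a _)
        split : is ++ rest ≡ now ++ later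
        split = trans (cong (_++ rest) (sym (take++drop≡id a is))) (++-assoc now (drop a is) rest)
        c : Fin n → ℕ
        c j = queryCount (search (suc k) a is u g) (oracle X (x j))
        cost≤ : searchCost (suc k) a is u g (is ++ rest) ≤ d * d + (d * m + T)
        cost≤ = begin
          sum (map c (is ++ rest))
            ≡⟨ cong (sum ∘ map c) split ⟩
          sum (map c (now ++ later))
            ≡⟨ trans (cong sum (map-++ c now later)) (sum-++ (map c now) (map c later)) ⟩
          sum (map c now) + sum (map c later)
            ≤⟨ +-mono-≤ (sum-map-bounded now (λ j j∈ → ≤-reflexive (queryCount-search-∈ X j k a is u g j∈)))
                        (≤-trans (sum-map-≤ (λ j → queryCount-search X j k a is u g) later)
                                 (≤-reflexive (sum-map-+ d _ later))) ⟩
          d * d + (d * m + T) ∎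

    -- The round size a = ⌊s/k⌋ + 1 satisfies s ≤ ka ≤ s + k: the first inequality ensures that all
    -- `s` candidates are probed, the second produces the error term `k * s`. Divided by 2k, the
    -- bound reads T ≤ ns - (k - 1)s²/(2k) + s/2.
    upperBound : ∀ {k s} → 1 ≤ k → s < n → ∃[ A ] (∀ (X : Array n) →
      suc s ≤ successes X {k} A ×
      2 * (k * totalQueries X A) + k * (s * s) ≤ 2 * (k * (n * s)) + s * s + k * s)
    upperBound {k@(suc _)} {s} _ s<n with drop s (allFin n) in eq
    ... | [] = contradiction
      (trans (cong (_∸ s) (sym (length-tabulate id)))
             (trans (sym (length-drop s (allFin n))) (cong length eq)))
      (>⇒≢ (m<n⇒0<n∸m s<n))
    -- Since `s < n`, some entry is left unprobed; the first such entry is the guess.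
    ... | g ∷ rest = A , λ X → successes≥ X , cost≤ X
      where
      a : ℕ
      a = suc (s / k)
      is : List (Fin n)
      is = take s (allFin n)
      length-is : length is ≡ s
      length-is = trans (length-take s (allFin n)) (trans (cong (s ⊓_) (length-tabulate id)) (m≤n⇒m⊓n≡m (<⇒≤ s<n)))
      u : Unique is
      u = take⁺ s (allFin⁺ n)
      A : Algorithm n k
      A = search k a is u g
      split : is ++ g ∷ rest ≡ allFin n
      split = trans (cong (is ++_) (sym eq)) (take++drop≡id s (allFin n))
      ka≥s : length is ≤ k * a
      ka≥s = begin
        length is              ≡⟨ length-is ⟩
        s                      ≡⟨ m≡m%n+[m/n]*n s k ⟩
        s % k + (s / k) * k    ≤⟨ +-monoˡ-≤ _ (<⇒≤ (m%n<n s k)) ⟩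
        k + (s / k) * k        ≡⟨ *-comm a k ⟩
        k * a                  ∎
        where open ≤-Reasoning
      ka≤s+k : k * a ≤ s + k
      ka≤s+k = begin
        k * a            ≡⟨ *-comm k a ⟩
        k + (s / k) * k  ≤⟨ +-monoʳ-≤ k (m/n*n≤m s k) ⟩
        k + s            ≡⟨ +-comm k s ⟩
        s + k            ∎
        where open ≤-Reasoning
      module _ (X : Array n) where
        open Array X using (x; _≈_; _≟_; order)
        open StrictTotalOrder order using (module Eq)
        Found : Fin n → Set
        Found j = x (result A (oracle X (x j))) ≈ x j
        found? = λ j → x (result A (oracle X (x j))) ≟ x j
        found : ∀ {j} → result A (oracle X (x j)) ≡ j → Found j
        found eq = Eq.reflexive (cong x eq)
        found-is : ∀ {j} → j ∈ is → Found j
        found-is {j} = found ∘ result-search-∈ X j k a is u g ka≥s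
        found-g : Found g
        found-g with g ∈? is
        ... | yes g∈is = found-is g∈is
        ... | no g∉is  = found (result-search-∉ X g k a is u g g∉is)
        successes≥ : suc s ≤ successes X A
        successes≥ = begin
          suc s                                      ≡⟨ cong suc (sym length-is) ⟩
          suc (length is)                            ≤⟨ m≤m+n _ (length (filter found? rest)) ⟩
          suc (length is + length (filter found? rest)) ≡⟨ sym (+-suc (length is) _) ⟩
          length is + suc (length (filter found? rest))
            ≡⟨ sym (cong₂ _+_ (cong length (filter-all found? (All.tabulate found-is)))
                              (cong length (filter-accept found? {xs = rest} found-g))) ⟩
          length (filter found? is) + length (filter found? (g ∷ rest))
            ≡⟨ sym (trans (cong length (filter-++ found? is (g ∷ rest))) (length-++ (filter found? is))) ⟩
          length (filter found? (is ++ g ∷ rest))    ≡⟨ cong (length ∘ filter found?) split ⟩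
          successes X A                              ∎
          where open ≤-Reasoning
        T e : ℕ
        T = totalQueries X A
        e = length (g ∷ rest)
        s+e≡n : s + e ≡ n
        s+e≡n = begin
          s + e                    ≡⟨ cong (_+ e) (sym length-is) ⟩
          length is + e            ≡⟨ sym (length-++ is) ⟩
          length (is ++ g ∷ rest)  ≡⟨ cong length split ⟩
          length (allFin n)        ≡⟨ length-tabulate id ⟩
          n                        ∎
          where open ≡-Reasoning
        total-bound : 2 * T + e * e + a * e ≤ (s + e) * (s + e) + a * (s + e)
        total-bound = subst₂ (λ js m → 2 * searchCost X k a is u g js + e * e + a * e ≤ m * m + a * m)
          split (trans (cong length split) (trans (length-tabulate id) (sym s+e≡n)))
          (searchCost-bound X k a is u g (g ∷ rest))
        -- Uses (s + e)² - e² = 2(s + e)s - s².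
        core : 2 * T + s * s ≤ 2 * ((s + e) * s) + a * s
        core = +-cancelʳ-≤ (e * e + a * e) _ _ (begin
          2 * T + s * s + (e * e + a * e)
            ≡⟨ solve 4 (λ T s e a → con 2 :* T :+ s :* s :+ (e :* e :+ a :* e) :=
                 (con 2 :* T :+ e :* e :+ a :* e) :+ s :* s) refl T s e a ⟩
          (2 * T + e * e + a * e) + s * s ≤⟨ +-monoˡ-≤ (s * s) total-bound ⟩
          ((s + e) * (s + e) + a * (s + e)) + s * s
            ≡⟨ solve 3 (λ s e a → ((s :+ e) :* (s :+ e) :+ a :* (s :+ e)) :+ s :* s :=
                 con 2 :* ((s :+ e) :* s) :+ a :* s :+ (e :* e :+ a :* e)) refl s e a ⟩
          2 * ((s + e) * s) + a * s + (e * e + a * e) ∎)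
          where open ≤-Reasoning
                open +-*-Solver
        cost≤ : 2 * (k * T) + k * (s * s) ≤ 2 * (k * (n * s)) + s * s + k * s
        cost≤ = begin
          2 * (k * T) + k * (s * s)
            ≡⟨ solve 3 (λ k T s → con 2 :* (k :* T) :+ k :* (s :* s) := k :* (con 2 :* T :+ s :* s)) refl k T s ⟩
          k * (2 * T + s * s)                ≤⟨ *-monoʳ-≤ k core ⟩
          k * (2 * ((s + e) * s) + a * s)    ≡⟨ cong (λ n → k * (2 * (n * s) + a * s)) s+e≡n ⟩
          k * (2 * (n * s) + a * s)
            ≡⟨ solve 4 (λ k n s a → k :* (con 2 :* (n :* s) :+ a :* s) :=
                 con 2 :* (k :* (n :* s)) :+ k :* a :* s) refl k n s a ⟩
          2 * (k * (n * s)) + k * a * s      ≤⟨ +-monoʳ-≤ _ (*-monoˡ-≤ s ka≤s+k) ⟩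
          2 * (k * (n * s)) + (s + k) * s
            ≡⟨ solve 3 (λ k n s → con 2 :* (k :* (n :* s)) :+ (s :+ k) :* s :=
                 con 2 :* (k :* (n :* s)) :+ s :* s :+ k :* s) refl k n s ⟩
          2 * (k * (n * s)) + s * s + k * s  ∎
          where open ≤-Reasoning
                open +-*-Solver

-- Arithmetic in an ordered field.

module OrderedFieldProperties {c ℓ₁ ℓ₂} (F : OrderedField c ℓ₁ ℓ₂) where

  open OrderedField F
  open Counting using (lowerBound; upperBound)
  open CommutativeRing commutativeRing public
    using (commutativeSemiring; +-cong; +-congˡ; +-congʳ; *-cong; *-congˡ; *-congʳ; -‿inverseˡ; -‿inverseʳ;
           +-identityˡ; +-identityʳ; *-identityʳ; +-assoc; +-comm; *-assoc; *-comm;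
           zeroˡ; zeroʳ; refl; sym; trans)
  open IsTotalOrder isTotalOrder public
    using (total; antisym; isPartialOrder) renaming (refl to ≤-refl; reflexive to ≤-reflexive; trans to ≤-trans)

  poset : Poset c ℓ₁ ℓ₂
  poset = record { isPartialOrder = isPartialOrder }

  open PartialOrderReasoning poset
  open NaturalCoefficients commutativeSemiring

  private
    two : ∀ {m} → Polynomial m
    two = con 1 :+ (con 1 :+ con 0)

  +-monoʳ-≤ : ∀ z {x y} → x ≤ y → z + x ≤ z + y
  +-monoʳ-≤ z {x} {y} x≤y = begin
    z + x ≈⟨ +-comm z x ⟩
    x + z ≤⟨ +-monoˡ-≤ z x≤y ⟩
    y + z ≈⟨ +-comm y z ⟩
    z + y ∎

  +-mono-≤ : ∀ {x y u v} → x ≤ y → u ≤ v → x + u ≤ y + v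
  +-mono-≤ {y = y} {u} x≤y u≤v = ≤-trans (+-monoˡ-≤ u x≤y) (+-monoʳ-≤ y u≤v)

  x-y+y≈x : ∀ x y → x - y + y ≈ x
  x-y+y≈x x y = trans (+-assoc x (- y) y) (trans (+-congˡ (-‿inverseˡ y)) (+-identityʳ x))

  x+y-y≈x : ∀ x y → x + y - y ≈ x
  x+y-y≈x x y = trans (+-assoc x y (- y)) (trans (+-congˡ (-‿inverseʳ y)) (+-identityʳ x))

  x≤y+z⇒x-z≤y : ∀ {x y z} → x ≤ y + z → x - z ≤ y
  x≤y+z⇒x-z≤y {x} {y} {z} x≤y+z = begin
    x - z     ≤⟨ +-monoˡ-≤ (- z) x≤y+z ⟩
    y + z - z ≈⟨ x+y-y≈x y z ⟩
    y         ∎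

  +-cancelʳ-≤ : ∀ {x y} z → x + z ≤ y + z → x ≤ y
  +-cancelʳ-≤ {x} {y} z x+z≤y+z = begin
    x         ≈⟨ x+y-y≈x x z ⟨
    x + z - z ≤⟨ x≤y+z⇒x-z≤y x+z≤y+z ⟩
    y         ∎

  x≤x+y : ∀ {x y} → 0# ≤ y → x ≤ x + y
  x≤x+y {x} {y} 0≤y = begin
    x      ≈⟨ +-identityʳ x ⟨
    x + 0# ≤⟨ +-monoʳ-≤ x 0≤y ⟩
    x + y  ∎

  -- Trades an inequality for a nonnegative difference, so that the algebra after it consists of
  -- identities in a commutative semiring.
  ≤⇒∃[d]x+d≈y : ∀ {x y} → x ≤ y → ∃[ d ] 0# ≤ d × x + d ≈ y
  ≤⇒∃[d]x+d≈y {x} {y} x≤y = y - x , 0≤y-x , trans (+-comm x (y - x)) (x-y+y≈x y x)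
    where
    0≤y-x : 0# ≤ y - x
    0≤y-x = begin
      0#    ≈⟨ -‿inverseʳ x ⟨
      x - x ≤⟨ +-monoˡ-≤ (- x) x≤y ⟩
      y - x ∎

  *-monoʳ-≤ : ∀ {z x y} → 0# ≤ z → x ≤ y → z * x ≤ z * y
  *-monoʳ-≤ {z} {x} {y} 0≤z x≤y with d , 0≤d , x+d≈y ← ≤⇒∃[d]x+d≈y x≤y = begin
    z * x         ≤⟨ x≤x+y (*-nonNegative 0≤z 0≤d) ⟩
    z * x + z * d ≈⟨ solve 3 (λ z x d → z :* x :+ z :* d := z :* (x :+ d)) refl z x d ⟩
    z * (x + d)   ≈⟨ *-congˡ x+d≈y ⟩
    z * y         ∎

  -- If 1 ≤ 0, then d = -1 is nonnegative, and hence so is d² = 1.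
  0≤1 : 0# ≤ 1#
  0≤1 with total 0# 1#
  ... | inj₁ 0≤1 = 0≤1
  ... | inj₂ 1≤0 with d , 0≤d , 1+d≈0 ← ≤⇒∃[d]x+d≈y 1≤0 = begin
    0#                ≤⟨ *-nonNegative 0≤d 0≤d ⟩
    d * d             ≈⟨ +-identityˡ (d * d) ⟨
    0# + d * d        ≈⟨ +-congʳ 1+d≈0 ⟨
    1# + d + d * d    ≈⟨ solve 1 (λ d → con 1 :+ d :+ d :* d := con 1 :+ d :* (con 1 :+ d)) refl d ⟩
    1# + d * (1# + d) ≈⟨ +-congˡ (trans (*-congˡ 1+d≈0) (zeroʳ d)) ⟩
    1# + 0#           ≈⟨ +-identityʳ 1# ⟩
    1#                ∎

  fromℕ-nonNegative : ∀ n → 0# ≤ fromℕ n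
  fromℕ-nonNegative zero    = ≤-refl
  fromℕ-nonNegative (suc n) = ≤-trans 0≤1 (x≤x+y (fromℕ-nonNegative n))

  fromℕ-mono : ∀ {m n} → m ℕ.≤ n → fromℕ m ≤ fromℕ n
  fromℕ-mono {n = n} z≤n = fromℕ-nonNegative n
  fromℕ-mono (s≤s m≤n)   = +-monoʳ-≤ 1# (fromℕ-mono m≤n)

  fromℕ-+ : ∀ m n → fromℕ (m ℕ.+ n) ≈ fromℕ m + fromℕ n
  fromℕ-+ zero    n = sym (+-identityˡ (fromℕ n))
  fromℕ-+ (suc m) n = trans (+-congˡ (fromℕ-+ m n)) (sym (+-assoc 1# (fromℕ m) (fromℕ n)))

  fromℕ-* : ∀ m n → fromℕ (m ℕ.* n) ≈ fromℕ m * fromℕ n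
  fromℕ-* zero    n = sym (zeroˡ (fromℕ n))
  fromℕ-* (suc m) n = trans (fromℕ-+ n (m ℕ.* n)) (trans (+-congˡ (fromℕ-* m n))
    (solve 2 (λ m n → n :+ m :* n := (con 1 :+ m) :* n) refl (fromℕ m) (fromℕ n)))

  fromℕ≉0 : ∀ n → ¬ (fromℕ (suc n) ≈ 0#)
  fromℕ≉0 n 1+n≈0 = 0≉1 (antisym 0≤1 (≤-trans (x≤x+y (fromℕ-nonNegative n)) (≤-reflexive 1+n≈0)))

  z*[x/z]≈x : ∀ {z} x → ¬ (z ≈ 0#) → z * (x / z) ≈ x
  z*[x/z]≈x {z} x z≉0 = trans (solve 3 (λ z x i → z :* (x :* i) := x :* (z :* i)) refl z x (z ⁻¹))
    (trans (*-congˡ (⁻¹-inverseʳ z z≉0)) (*-identityʳ x))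

  -- By totality only `y ≤ x` needs an argument: then `z * x ≈ z * y` by antisymmetry, and dividing
  -- by `z` gives `x ≈ y`. The sign of `z ⁻¹` never enters.
  *-cancelˡ-≤ : ∀ {z x y} → 0# ≤ z → ¬ (z ≈ 0#) → z * x ≤ z * y → x ≤ y
  *-cancelˡ-≤ {z} {x} {y} 0≤z z≉0 zx≤zy with total x y
  ... | inj₁ x≤y = x≤y
  ... | inj₂ y≤x = begin
    x              ≈⟨ z*[x/z]≈x x z≉0 ⟨
    z * (x / z)    ≈⟨ *-assoc z x (z ⁻¹) ⟨
    z * x / z      ≈⟨ *-congʳ (antisym zx≤zy (*-monoʳ-≤ 0≤z y≤x)) ⟩
    z * y / z      ≈⟨ *-assoc z y (z ⁻¹) ⟩
    z * (y / z)    ≈⟨ z*[x/z]≈x y z≉0 ⟩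
    y              ∎

  *-nonZero : ∀ {x y} → ¬ (x ≈ 0#) → ¬ (y ≈ 0#) → ¬ (x * y ≈ 0#)
  *-nonZero {x} {y} x≉0 y≉0 xy≈0 = y≉0 (begin-equality
    y                ≈⟨ z*[x/z]≈x y x≉0 ⟨
    x * (y * x ⁻¹)   ≈⟨ *-assoc x y (x ⁻¹) ⟨
    x * y * x ⁻¹     ≈⟨ *-congʳ xy≈0 ⟩
    0# * x ⁻¹        ≈⟨ zeroˡ (x ⁻¹) ⟩
    0#               ∎)

  -- Rounding to integers.

  -- Here s is ⌈ y ⌉ ∸ 1, or 0 for y ≈ 0#; the bound on y replaces the Archimedean property.
  between-naturals : ∀ m {y} → 0# ≤ y → y ≤ fromℕ (suc m) →
    ∃[ s ] s ℕ.< suc m × fromℕ s ≤ y × y ≤ fromℕ (suc s)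
  between-naturals zero    0≤y y≤1 = 0 , s≤s z≤n , 0≤y , y≤1
  between-naturals (suc m) {y} 0≤y y≤2+m with total (fromℕ (suc m)) y
  ... | inj₁ 1+m≤y = suc m , ℕ.≤-refl , 1+m≤y , y≤2+m
  ... | inj₂ y≤1+m with s , s<1+m , s≤y≤1+s ← between-naturals m 0≤y y≤1+m = s , ℕ.m≤n⇒m≤1+n s<1+m , s≤y≤1+s

  -- With k = 1# + K, the function g y = 2 k N y − K y² has a slope between 0 and 2 k N
  -- on [0, N], so replacing y by an integer at distance at most 1 costs at most 2 k N.
  -- The inequalities are arranged so that no subtraction occurs.
  module _ {K N : Carrier} (0≤K : 0# ≤ K) (0≤N : 0# ≤ N) where

    private
      k : Carrier
      k = 1# + K

    -- The left side is K((x + d)² - x²), the growth of the quadratic term of g over a step `d`. The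
    -- linear term grows at least as much, so g does not decrease.
    growth : ∀ {x d} → 0# ≤ d → x + d ≤ N → x ≤ N →
             K * (d * (x + (x + d))) ≤ fromℕ 2 * (k * (N * d))
    growth {x} {d} 0≤d x+d≤N x≤N = begin
      K * (d * (x + (x + d)))
        ≤⟨ *-monoʳ-≤ 0≤K (*-monoʳ-≤ 0≤d (+-mono-≤ x≤N x+d≤N)) ⟩
      K * (d * (N + N))
        ≤⟨ x≤x+y (*-nonNegative 0≤d (≤-trans 0≤N (x≤x+y 0≤N))) ⟩
      K * (d * (N + N)) + d * (N + N)
        ≈⟨ solve 3 (λ K d N → K :* (d :* (N :+ N)) :+ d :* (N :+ N) :=
             two :* ((con 1 :+ K) :* (N :* d))) refl K d N ⟩
      fromℕ 2 * (k * (N * d)) ∎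

    -- The hypothesis says g(D) ≤ 2kT. If y ≤ D, monotonicity of g suffices. If D ≤ y ≤ D + 1, the
    -- linear term gains at most 2kN, which is the allowed slack, and D² ≤ y² takes care of the
    -- quadratic term.
    lower-numeric : ∀ {y D T} → 0# ≤ y → D ≤ N → y ≤ 1# + D → 0# ≤ D →
      fromℕ 2 * (k * (N * D)) + D * D ≤ fromℕ 2 * (k * T) + k * (D * D) →
      fromℕ 2 * (k * (N * y)) ≤ fromℕ 2 * (k * T) + fromℕ 2 * (k * N) + K * (y * y)
    lower-numeric {y} {D} {T} 0≤y D≤N y≤1+D 0≤D h with total y D
    ... | inj₁ y≤D with d , 0≤d , y+d≈D ← ≤⇒∃[d]x+d≈y y≤D = +-cancelʳ-≤ (fromℕ 2 * (k * (N * d))) (begin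
      fromℕ 2 * (k * (N * y)) + fromℕ 2 * (k * (N * d))
        ≈⟨ solve 4 (λ k N y d → two :* (k :* (N :* y)) :+ two :* (k :* (N :* d)) :=
             two :* (k :* (N :* (y :+ d)))) refl k N y d ⟩
      fromℕ 2 * (k * (N * (y + d)))
        ≤⟨ h′ ⟩
      fromℕ 2 * (k * T) + K * ((y + d) * (y + d))
        ≈⟨ solve 5 (λ k T K y d → two :* (k :* T) :+ K :* ((y :+ d) :* (y :+ d)) :=
             two :* (k :* T) :+ K :* (y :* y) :+ K :* (d :* (y :+ (y :+ d)))) refl k T K y d ⟩
      fromℕ 2 * (k * T) + K * (y * y) + K * (d * (y + (y + d)))
        ≤⟨ +-mono-≤ (+-monoˡ-≤ _ (x≤x+y 0≤2kN)) (growth 0≤d y+d≤N (≤-trans y≤D D≤N)) ⟩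
      fromℕ 2 * (k * T) + fromℕ 2 * (k * N) + K * (y * y) + fromℕ 2 * (k * (N * d)) ∎)
      where
      y+d≤N : y + d ≤ N
      y+d≤N = ≤-trans (≤-reflexive y+d≈D) D≤N
      0≤2kN : 0# ≤ fromℕ 2 * (k * N)
      0≤2kN = *-nonNegative (fromℕ-nonNegative 2) (*-nonNegative (≤-trans 0≤1 (x≤x+y 0≤K)) 0≤N)
      h′ : fromℕ 2 * (k * (N * (y + d))) ≤ fromℕ 2 * (k * T) + K * ((y + d) * (y + d))
      h′ = +-cancelʳ-≤ ((y + d) * (y + d)) (begin
        fromℕ 2 * (k * (N * (y + d))) + (y + d) * (y + d)
          ≈⟨ +-cong (*-congˡ (*-congˡ (*-congˡ y+d≈D))) (*-cong y+d≈D y+d≈D) ⟩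
        fromℕ 2 * (k * (N * D)) + D * D
          ≤⟨ h ⟩
        fromℕ 2 * (k * T) + k * (D * D)
          ≈⟨ +-congˡ (*-congˡ (*-cong y+d≈D y+d≈D)) ⟨
        fromℕ 2 * (k * T) + k * ((y + d) * (y + d))
          ≈⟨ solve 3 (λ K T D → two :* ((con 1 :+ K) :* T) :+ (con 1 :+ K) :* (D :* D) :=
               two :* ((con 1 :+ K) :* T) :+ K :* (D :* D) :+ D :* D) refl K T (y + d) ⟩
        fromℕ 2 * (k * T) + K * ((y + d) * (y + d)) + (y + d) * (y + d) ∎)
    ... | inj₂ D≤y with d , 0≤d , D+d≈y ← ≤⇒∃[d]x+d≈y D≤y = begin
      fromℕ 2 * (k * (N * y))
        ≈⟨ *-congˡ (*-congˡ (*-congˡ D+d≈y)) ⟨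
      fromℕ 2 * (k * (N * (D + d)))
        ≈⟨ solve 4 (λ k N D d → two :* (k :* (N :* (D :+ d))) :=
             two :* (k :* (N :* D)) :+ two :* (k :* N) :* d) refl k N D d ⟩
      fromℕ 2 * (k * (N * D)) + fromℕ 2 * (k * N) * d
        ≤⟨ +-mono-≤ h′ (*-monoʳ-≤ 0≤2kN d≤1) ⟩
      fromℕ 2 * (k * T) + K * (D * D) + fromℕ 2 * (k * N) * 1#
        ≤⟨ +-monoˡ-≤ _ (+-monoʳ-≤ _ (*-monoʳ-≤ 0≤K D²≤y²)) ⟩
      fromℕ 2 * (k * T) + K * (y * y) + fromℕ 2 * (k * N) * 1#
        ≈⟨ solve 5 (λ k T K y N → two :* (k :* T) :+ K :* (y :* y) :+ two :* (k :* N) :* con 1 :=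
             two :* (k :* T) :+ two :* (k :* N) :+ K :* (y :* y)) refl k T K y N ⟩
      fromℕ 2 * (k * T) + fromℕ 2 * (k * N) + K * (y * y) ∎
      where
      0≤2kN : 0# ≤ fromℕ 2 * (k * N)
      0≤2kN = *-nonNegative (fromℕ-nonNegative 2) (*-nonNegative (≤-trans 0≤1 (x≤x+y 0≤K)) 0≤N)
      d≤1 : d ≤ 1#
      d≤1 = +-cancelʳ-≤ D (≤-trans (≤-reflexive (trans (+-comm d D) D+d≈y)) y≤1+D)
      D²≤y² : D * D ≤ y * y
      D²≤y² = begin
        D * D ≤⟨ *-monoʳ-≤ 0≤D D≤y ⟩
        D * y ≈⟨ *-comm D y ⟩
        y * D ≤⟨ *-monoʳ-≤ 0≤y D≤y ⟩
        y * y ∎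
      h′ : fromℕ 2 * (k * (N * D)) ≤ fromℕ 2 * (k * T) + K * (D * D)
      h′ = +-cancelʳ-≤ (D * D) (≤-trans h (≤-reflexive
        (solve 3 (λ K T D → two :* ((con 1 :+ K) :* T) :+ (con 1 :+ K) :* (D :* D) :=
           two :* ((con 1 :+ K) :* T) :+ K :* (D :* D) :+ D :* D) refl K T D)))

    -- As g(s) ≤ g(y) by `growth`, the only loss is the error term `k * s`, and s ≤ N keeps it
    -- within the slack 2kN.
    upper-numeric : ∀ {y s T} → s ≤ y → y ≤ N →
      fromℕ 2 * (k * T) + k * (s * s) ≤ fromℕ 2 * (k * (N * s)) + s * s + k * s →
      fromℕ 2 * (k * T) + K * (y * y) ≤ fromℕ 2 * (k * (N * y)) + fromℕ 2 * (k * N)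
    upper-numeric {y} {s} {T} s≤y y≤N h with d , 0≤d , s+d≈y ← ≤⇒∃[d]x+d≈y s≤y = begin
      fromℕ 2 * (k * T) + K * (y * y)
        ≈⟨ +-congˡ (*-congˡ (*-cong s+d≈y s+d≈y)) ⟨
      fromℕ 2 * (k * T) + K * ((s + d) * (s + d))
        ≈⟨ solve 5 (λ k T K s d → two :* (k :* T) :+ K :* ((s :+ d) :* (s :+ d)) :=
             two :* (k :* T) :+ K :* (s :* s) :+ K :* (d :* (s :+ (s :+ d)))) refl k T K s d ⟩
      fromℕ 2 * (k * T) + K * (s * s) + K * (d * (s + (s + d)))
        ≤⟨ +-mono-≤ h′ (growth 0≤d (≤-trans (≤-reflexive s+d≈y) y≤N) s≤N) ⟩
      fromℕ 2 * (k * (N * s)) + k * s + fromℕ 2 * (k * (N * d))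
        ≤⟨ +-monoˡ-≤ _ (+-monoʳ-≤ _ (≤-trans (*-monoʳ-≤ 0≤k s≤N) (x≤x+y (*-nonNegative 0≤k 0≤N)))) ⟩
      fromℕ 2 * (k * (N * s)) + (k * N + k * N) + fromℕ 2 * (k * (N * d))
        ≈⟨ solve 4 (λ k N s d → two :* (k :* (N :* s)) :+ (k :* N :+ k :* N) :+ two :* (k :* (N :* d)) :=
             two :* (k :* (N :* (s :+ d))) :+ two :* (k :* N)) refl k N s d ⟩
      fromℕ 2 * (k * (N * (s + d))) + fromℕ 2 * (k * N)
        ≈⟨ +-congʳ (*-congˡ (*-congˡ (*-congˡ s+d≈y))) ⟩
      fromℕ 2 * (k * (N * y)) + fromℕ 2 * (k * N) ∎
      where
      0≤k : 0# ≤ k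
      0≤k = ≤-trans 0≤1 (x≤x+y 0≤K)
      s≤N : s ≤ N
      s≤N = ≤-trans s≤y y≤N
      h′ : fromℕ 2 * (k * T) + K * (s * s) ≤ fromℕ 2 * (k * (N * s)) + k * s
      h′ = +-cancelʳ-≤ (s * s) (begin
        fromℕ 2 * (k * T) + K * (s * s) + s * s
          ≈⟨ solve 3 (λ K T s → two :* ((con 1 :+ K) :* T) :+ (con 1 :+ K) :* (s :* s) :=
               two :* ((con 1 :+ K) :* T) :+ K :* (s :* s) :+ s :* s) refl K T s ⟨
        fromℕ 2 * (k * T) + k * (s * s)
          ≤⟨ h ⟩
        fromℕ 2 * (k * (N * s)) + s * s + k * s
          ≈⟨ solve 3 (λ a b c → a :+ b :+ c := a :+ c :+ b) refl _ (s * s) (k * s) ⟩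
        fromℕ 2 * (k * (N * s)) + k * s + s * s ∎)

    -- Dividing by the common denominator.

    module _ (N≉0 : ¬ (N ≈ 0#)) (2≉0 : ¬ (fromℕ 2 ≈ 0#)) (k≉0 : ¬ (k ≈ 0#)) (p : Carrier) where

      private
        C y b c₀ : Carrier
        C  = (k - 1#) / (fromℕ 2 * k)
        y  = N * p
        b  = N * p * (1# - C * p)
        c₀ = fromℕ 2 * (k * N)

        0≤c₀ : 0# ≤ c₀
        0≤c₀ = *-nonNegative (fromℕ-nonNegative 2) (*-nonNegative (≤-trans 0≤1 (x≤x+y 0≤K)) 0≤N)

        c₀≉0 : ¬ (c₀ ≈ 0#)
        c₀≉0 = *-nonZero 2≉0 (*-nonZero k≉0 N≉0)

        2kC≈K : fromℕ 2 * k * C ≈ K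
        2kC≈K = begin-equality
          fromℕ 2 * k * C ≈⟨ z*[x/z]≈x (k - 1#) (*-nonZero 2≉0 k≉0) ⟩
          1# + K - 1#     ≈⟨ +-congʳ (+-comm 1# K) ⟩
          K + 1# - 1#     ≈⟨ x+y-y≈x K 1# ⟩
          K               ∎

        -- Says that `c₀ * b` is g(Np): multiplying by c₀ = 2kN clears the denominator of `C` and
        -- turns the claimed bound into the quadratic used for rounding.
        c₀b+Ky²≈2kNy : c₀ * b + K * (y * y) ≈ fromℕ 2 * (k * (N * y))
        c₀b+Ky²≈2kNy = begin-equality
          c₀ * b + K * (y * y)
            ≈⟨ +-congˡ (*-congʳ 2kC≈K) ⟨
          c₀ * b + fromℕ 2 * k * C * (y * y)
            -- The factor 1 - Cp enters as an atom `w`, which keeps the identity free of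
            -- subtraction.
            ≈⟨ solve 5 (λ k N p C w →
                 two :* (k :* N) :* (N :* p :* w) :+ two :* k :* C :* ((N :* p) :* (N :* p)) :=
                 two :* (k :* (N :* (N :* p))) :* (w :+ C :* p)) refl k N p C (1# - C * p) ⟩
          fromℕ 2 * (k * (N * y)) * (1# - C * p + C * p)
            ≈⟨ *-congˡ (x-y+y≈x 1# (C * p)) ⟩
          fromℕ 2 * (k * (N * y)) * 1#
            ≈⟨ *-identityʳ (fromℕ 2 * (k * (N * y))) ⟩
          fromℕ 2 * (k * (N * y)) ∎

        c₀[x/N]≈2kx : ∀ x → c₀ * (x / N) ≈ fromℕ 2 * (k * x)
        c₀[x/N]≈2kx x = begin-equality
          c₀ * (x / N)
            ≈⟨ solve 3 (λ k N q → two :* (k :* N) :* q := two :* (k :* (N :* q))) refl k N (x / N) ⟩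
          fromℕ 2 * (k * (N * (x / N)))
            ≈⟨ *-congˡ (*-congˡ (z*[x/z]≈x x N≉0)) ⟩
          fromℕ 2 * (k * x) ∎

      -- The slack 2kN in the rounding estimate is exactly `c₀`, so after division it becomes the
      -- additive constant 1.
      lower-ratio : ∀ {D T} → 0# ≤ p → D ≤ N → N * p ≤ 1# + D → 0# ≤ D →
        fromℕ 2 * (k * (N * D)) + D * D ≤ fromℕ 2 * (k * T) + k * (D * D) →
        N * p * (1# - (k - 1#) / (fromℕ 2 * k) * p) - 1# ≤ T / N
      lower-ratio {D} {T} 0≤p D≤N y≤1+D 0≤D h =
        x≤y+z⇒x-z≤y (*-cancelˡ-≤ 0≤c₀ c₀≉0 (+-cancelʳ-≤ (K * (y * y)) (begin
          c₀ * b + K * (y * y)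
            ≈⟨ c₀b+Ky²≈2kNy ⟩
          fromℕ 2 * (k * (N * y))
            ≤⟨ lower-numeric (*-nonNegative 0≤N 0≤p) D≤N y≤1+D 0≤D h ⟩
          fromℕ 2 * (k * T) + c₀ + K * (y * y)
            ≈⟨ +-congʳ (+-congʳ (c₀[x/N]≈2kx T)) ⟨
          c₀ * (T / N) + c₀ + K * (y * y)
            ≈⟨ solve 3 (λ c q z → c :* q :+ c :+ z := c :* (q :+ con 1) :+ z) refl c₀ (T / N) (K * (y * y)) ⟩
          c₀ * (T / N + 1#) + K * (y * y) ∎)))

      upper-ratio : ∀ {s T} → s ≤ N * p → N * p ≤ N →
        fromℕ 2 * (k * T) + k * (s * s) ≤ fromℕ 2 * (k * (N * s)) + s * s + k * s →
        T / N ≤ N * p * (1# - (k - 1#) / (fromℕ 2 * k) * p) + 1#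
      upper-ratio {s} {T} s≤y y≤N h = *-cancelˡ-≤ 0≤c₀ c₀≉0 (+-cancelʳ-≤ (K * (y * y)) (begin
        c₀ * (T / N) + K * (y * y)             ≈⟨ +-congʳ (c₀[x/N]≈2kx T) ⟩
        fromℕ 2 * (k * T) + K * (y * y)        ≤⟨ upper-numeric s≤y y≤N h ⟩
        fromℕ 2 * (k * (N * y)) + c₀           ≈⟨ +-congʳ c₀b+Ky²≈2kNy ⟨
        c₀ * b + K * (y * y) + c₀
          ≈⟨ solve 3 (λ c b z → c :* b :+ z :+ c := c :* (b :+ con 1) :+ z) refl c₀ b (K * (y * y)) ⟩
        c₀ * (b + 1#) + K * (y * y) ∎))

  -- Transfer of the counting inequalities to the field.

  fromℕ-2ka : ∀ k a → fromℕ (2 ℕ.* (k ℕ.* a)) ≈ fromℕ 2 * (fromℕ k * fromℕ a)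
  fromℕ-2ka k a = trans (fromℕ-* 2 (k ℕ.* a)) (*-congˡ (fromℕ-* k a))

  fromℕ-2kab : ∀ k a b → fromℕ (2 ℕ.* (k ℕ.* (a ℕ.* b))) ≈ fromℕ 2 * (fromℕ k * (fromℕ a * fromℕ b))
  fromℕ-2kab k a b = trans (fromℕ-2ka k (a ℕ.* b)) (*-congˡ (*-congˡ (fromℕ-* a b)))

  fromℕ-kaa : ∀ k a → fromℕ (k ℕ.* (a ℕ.* a)) ≈ fromℕ k * (fromℕ a * fromℕ a)
  fromℕ-kaa k a = trans (fromℕ-* k (a ℕ.* a)) (*-congˡ (fromℕ-* a a))

  fromℕ-lower : ∀ n k D T → 2 ℕ.* (k ℕ.* (n ℕ.* D)) ℕ.+ D ℕ.* D ℕ.≤ 2 ℕ.* (k ℕ.* T) ℕ.+ k ℕ.* (D ℕ.* D) →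
    fromℕ 2 * (fromℕ k * (fromℕ n * fromℕ D)) + fromℕ D * fromℕ D ≤
    fromℕ 2 * (fromℕ k * fromℕ T) + fromℕ k * (fromℕ D * fromℕ D)
  fromℕ-lower n k D T h = begin
    fromℕ 2 * (fromℕ k * (fromℕ n * fromℕ D)) + fromℕ D * fromℕ D
      ≈⟨ trans (fromℕ-+ (2 ℕ.* (k ℕ.* (n ℕ.* D))) (D ℕ.* D)) (+-cong (fromℕ-2kab k n D) (fromℕ-* D D)) ⟨
    fromℕ (2 ℕ.* (k ℕ.* (n ℕ.* D)) ℕ.+ D ℕ.* D)
      ≤⟨ fromℕ-mono h ⟩
    fromℕ (2 ℕ.* (k ℕ.* T) ℕ.+ k ℕ.* (D ℕ.* D))
      ≈⟨ trans (fromℕ-+ (2 ℕ.* (k ℕ.* T)) (k ℕ.* (D ℕ.* D))) (+-cong (fromℕ-2ka k T) (fromℕ-kaa k D)) ⟩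
    fromℕ 2 * (fromℕ k * fromℕ T) + fromℕ k * (fromℕ D * fromℕ D) ∎

  fromℕ-upper : ∀ n k s T →
    2 ℕ.* (k ℕ.* T) ℕ.+ k ℕ.* (s ℕ.* s) ℕ.≤ 2 ℕ.* (k ℕ.* (n ℕ.* s)) ℕ.+ s ℕ.* s ℕ.+ k ℕ.* s →
    fromℕ 2 * (fromℕ k * fromℕ T) + fromℕ k * (fromℕ s * fromℕ s) ≤
    fromℕ 2 * (fromℕ k * (fromℕ n * fromℕ s)) + fromℕ s * fromℕ s + fromℕ k * fromℕ s
  fromℕ-upper n k s T h = begin
    fromℕ 2 * (fromℕ k * fromℕ T) + fromℕ k * (fromℕ s * fromℕ s)
      ≈⟨ trans (fromℕ-+ (2 ℕ.* (k ℕ.* T)) (k ℕ.* (s ℕ.* s))) (+-cong (fromℕ-2ka k T) (fromℕ-kaa k s)) ⟨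
    fromℕ (2 ℕ.* (k ℕ.* T) ℕ.+ k ℕ.* (s ℕ.* s))
      ≤⟨ fromℕ-mono h ⟩
    fromℕ (2 ℕ.* (k ℕ.* (n ℕ.* s)) ℕ.+ s ℕ.* s ℕ.+ k ℕ.* s)
      ≈⟨ trans (fromℕ-+ (2 ℕ.* (k ℕ.* (n ℕ.* s)) ℕ.+ s ℕ.* s) (k ℕ.* s))
           (+-cong (trans (fromℕ-+ (2 ℕ.* (k ℕ.* (n ℕ.* s))) (s ℕ.* s))
                          (+-cong (fromℕ-2kab k n s) (fromℕ-* s s)))
                   (fromℕ-* k s)) ⟩
    fromℕ 2 * (fromℕ k * (fromℕ n * fromℕ s)) + fromℕ s * fromℕ s + fromℕ k * fromℕ s ∎

  -- The two bounds in terms of the success probability.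

  module _ (n′ k′ : ℕ) (p : Carrier) (0≤p : 0# ≤ p) (p≤1 : p ≤ 1#) where

    private
      n k : ℕ
      n = suc n′
      k = suc k′
      N : Carrier
      N = fromℕ n

      0≤N : 0# ≤ N
      0≤N = fromℕ-nonNegative n

      Np≤N : N * p ≤ N
      Np≤N = ≤-trans (*-monoʳ-≤ 0≤N p≤1) (≤-reflexive (*-identityʳ N))

    -- certify is a separate function because abstracting over lowerBound or
    -- upperBound by with would normalise them.
    asksAtLeast : (A : Algorithm n k) → SucceedsWithProbability F A p → AsksAtLeast F A (bound F n k p - 1#)
    asksAtLeast A succeeds = certify (lowerBound (s≤s z≤n) A)
      where
      certify : ∃[ X ] ∃[ D ] D ℕ.≤ n × successes X A ℕ.≤ suc D ×
                2 ℕ.* (k ℕ.* (n ℕ.* D)) ℕ.+ D ℕ.* D ℕ.≤ 2 ℕ.* (k ℕ.* totalQueries X A) ℕ.+ k ℕ.* (D ℕ.* D) →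
                AsksAtLeast F A (bound F n k p - 1#)
      certify (X , D , D≤n , successes≤ , h) = X ,
        lower-ratio (fromℕ-nonNegative k′) 0≤N (fromℕ≉0 n′) (fromℕ≉0 1) (fromℕ≉0 k′) p
          0≤p (fromℕ-mono D≤n) Np≤1+D (fromℕ-nonNegative D) (fromℕ-lower n k D (totalQueries X A) h)
        where
        Np≤1+D : N * p ≤ fromℕ (suc D)
        Np≤1+D = begin
          N * p                               ≤⟨ *-monoʳ-≤ 0≤N (succeeds X) ⟩
          N * (fromℕ (successes X A) / N)     ≈⟨ z*[x/z]≈x (fromℕ (successes X A)) (fromℕ≉0 n′) ⟩
          fromℕ (successes X A)               ≤⟨ fromℕ-mono successes≤ ⟩
          fromℕ (suc D)                       ∎

    searchAlgorithm : ∃[ A ] (SucceedsWithProbability F {n} {k} A p × AsksAtMost F A (bound F n k p + 1#))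
    -- `s < n` leaves an entry for the guess, which supplies the one success beyond `s` that reaches
    -- np ≤ s + 1.
    searchAlgorithm with s , s<n , s≤Np , Np≤1+s ← between-naturals n′ (*-nonNegative 0≤N 0≤p) Np≤N =
      certify (upperBound (s≤s z≤n) s<n)
      where
      certify : (∃[ A ] (∀ (X : Array n) → suc s ℕ.≤ successes X {k} A ×
                  2 ℕ.* (k ℕ.* totalQueries X A) ℕ.+ k ℕ.* (s ℕ.* s) ℕ.≤
                  2 ℕ.* (k ℕ.* (n ℕ.* s)) ℕ.+ s ℕ.* s ℕ.+ k ℕ.* s)) →
                ∃[ A ] (SucceedsWithProbability F {n} {k} A p × AsksAtMost F A (bound F n k p + 1#))
      certify (A , spec) = A , succeeds , λ X →
        upper-ratio (fromℕ-nonNegative k′) 0≤N (fromℕ≉0 n′) (fromℕ≉0 1) (fromℕ≉0 k′) p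
          s≤Np Np≤N (fromℕ-upper n k s (totalQueries X A) (proj₂ (spec X)))
        where
        succeeds : SucceedsWithProbability F A p
        succeeds X = *-cancelˡ-≤ 0≤N (fromℕ≉0 n′) (begin
          N * p                           ≤⟨ Np≤1+s ⟩
          fromℕ (suc s)                   ≤⟨ fromℕ-mono (proj₁ (spec X)) ⟩
          fromℕ (successes X A)           ≈⟨ z*[x/z]≈x (fromℕ (successes X A)) (fromℕ≉0 n′) ⟨
          N * (fromℕ (successes X A) / N) ∎)

open import Data.Nat using (_≤_)

theorem2 : ∀ {c ℓ₁ ℓ₂} (F : OrderedField c ℓ₁ ℓ₂) (n k : ℕ) (p : OrderedField.Carrier F) →
    let module F = OrderedField F in
    1 ≤ n → 1 ≤ k → k ≤ n → F.0# F.≤ p → p F.≤ F.1# →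
    ((A : Algorithm n k) → SucceedsWithProbability F A p →
    AsksAtLeast F A (bound F n k p F.- F.1#))
    ×
    (∃[ A ] (SucceedsWithProbability F {n} {k} A p ×
    AsksAtMost F A (bound F n k p F.+ F.1#)))
theorem2 F (suc n) (suc k) p _ _ _ 0≤p p≤1 =
  asksAtLeast n k p 0≤p p≤1 , searchAlgorithm n k p 0≤p p≤1
  where open OrderedFieldProperties F
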